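{- Let $G$ be a $(k,d,\lambda,\mu)$-strongly regular graph, and let $K$ be the corresponding CRG: $K$ has vertex set $V(G)$, all vertices black, with an edge of $K$ gray if its endpoints are adjacent in $G$ and white if they are nonadjacent in $G$. Then for all $p\in[0,1]$, $$f_K(p)=\frac1k+\left(\frac{k-d-2}{k}\right)p.$$ If $t$ is an integer with $\lambda\leq t-3$ and $\mu\leq t-1$, then $K$ forbids $K_{2,t}$ embedding (there is no colored homomorphism from $K_{2,t}$ to $K$); and if $\lambda=t-3$ and $\mu=t-1$, then $$f_K(p)=\frac{t-1}{t-1+d(d+1)}+\left(1-\frac{(d+2)(t-1)}{t-1+d(d+1)}\right)p.$$
   Context: A $(k,d,\lambda,\mu)$-strongly regular graph is a graph on $k$ vertices in which every vertex has degree $d$, each pair of adjacent vertices has exactly $\lambda$ common neighbors and each pair of distinct nonadjacent vertices has exactly $\mu$ common neighbors (with $\lambda,\mu$ nonnegative integers). A colored regularity graph (CRG) $K$ is a finite complete graph with each vertex colored black or white and each edge colored black, white or gray. For a CRG $K$ on $k$ vertices, with $\mathrm{VW},\mathrm{VB},\mathrm{EW},\mathrm{EB}$ its sets of white vertices, black vertices, white edges and black edges, $$f_K(p)=\frac{1}{k^2}\left[p\left(|\mathrm{VW}|+2|\mathrm{EW}|\right)+(1-p)\left(|\mathrm{VB}|+2|\mathrm{EB}|\right)\right].$$ A colored homomorphism (embedding) from a simple graph $H$ to a CRG $K$ is a map $\phi:V(H)\to V(K)$ such that for distinct $u,v\in V(H)$: if $uv\in E(H)$, then either $\phi(u)=\phi(v)$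 is a black vertex, or $\phi(u)\ne\phi(v)$ and the edge $\phi(u)\phi(v)$ is black or gray; if $uv\notin E(H)$, then either $\phi(u)=\phi(v)$ is a white vertex, or $\phi(u)\neq\phi(v)$ and the edge $\phi(u)\phi(v)$ is white or gray. $K_{2,t}$ is the complete bipartite graph with parts of sizes $2$ and $t$. -}

module Defs where

open import Algebra.Apartness.Bundles using (HeytingCommutativeRing; HeytingField)
open import Algebra.Bundles using (CommutativeRing)
import Algebra.Definitions.RawMonoid as Multiples
open import Data.Fin.Base using (Fin)
open import Data.Fin.Properties using () renaming (_<?_ to _<ᶠ?_)
open import Data.List.Base using (List; length; filter; allFin; cartesianProduct)
open import Data.Nat.Base as ℕ using (ℕ; zero; suc; NonZero)
import Data.Nat.Properties as ℕ
open import Data.Product.Base using (_×_; _,_; proj₁; proj₂; Σ-syntax)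
open import Data.Sum.Base using (_⊎_; inj₁; inj₂)
open import Function.Bundles using (_⇔_; Equivalence)
open import Level using (Level; 0ℓ; _⊔_) renaming (suc to lsuc)
open import Relation.Binary.Core using (Rel)
open import Relation.Binary.Definitions using (Decidable; DecidableEquality; Symmetric)
open import Relation.Binary.PropositionalEquality using (_≡_; _≢_; refl)
open import Relation.Binary.Structures using (IsStrictPartialOrder)
open import Relation.Nullary using (Dec; yes; no; ¬_; _×-dec_)
import Relation.Unary as U

-- The library has no real numbers.  Reals are replaced by an arbitrary ordered
-- field, in the constructive sense (no trichotomy is required), so that the
-- classical reals, the constructive reals and ℚ are all instances.

record OrderedField (c ℓ₁ ℓ₂ ℓ₃ : Level) : Set (lsuc (c ⊔ ℓ₁ ⊔ ℓ₂ ⊔ ℓ₃)) where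
  field
    heytingField : HeytingField c ℓ₁ ℓ₂
  open HeytingField heytingField public
  infix 4 _<_ _≤_
  field
    _<_                  : Rel Carrier ℓ₃
    isStrictPartialOrder : IsStrictPartialOrder _≈_ _<_
    #⇔<⊎>                : ∀ {x y} → x # y ⇔ (x < y ⊎ y < x)
    0<1                  : 0# < 1#
    +-monoˡ-<            : ∀ z {x y} → x < y → x + z < y + z
    *-pos                : ∀ {x y} → 0# < x → 0# < y → 0# < x * y

  module < = IsStrictPartialOrder isStrictPartialOrder

  _≤_ : Rel Carrier ℓ₃
  x ≤ y = ¬ (y < x)

  fromℕ : ℕ → Carrier
  fromℕ n = Multiples._×_ +-rawMonoid n 1#
    where
    open CommutativeRing (HeytingCommutativeRing.commutativeRing heytingCommutativeRing)
      using (+-rawMonoid)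

  -- #⇒invertible y#0 inverts y - 0#, which is ≈ y.
  infixl 7 _/_⟨_⟩
  _/_⟨_⟩ : (x y : Carrier) → y # 0# → Carrier
  x / y ⟨ y#0 ⟩ = x * proj₁ (#⇒invertible y#0)

  0<fromℕ-suc : ∀ n → 0# < fromℕ (suc n)
  0<fromℕ-suc zero    = <.<-respʳ-≈ (sym (+-identityʳ 1#)) 0<1
  0<fromℕ-suc (suc n) = <.trans (0<fromℕ-suc n)
    (<.<-respˡ-≈ (+-identityˡ (fromℕ (suc n))) (+-monoˡ-< (fromℕ (suc n)) 0<1))

  fromℕ#0 : ∀ n .{{_ : NonZero n}} → fromℕ n # 0#
  fromℕ#0 (suc n) = Equivalence.from #⇔<⊎> (inj₂ (0<fromℕ-suc n))

  infixl 7 _/ℕ_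
  _/ℕ_ : Carrier → (n : ℕ) .{{_ : NonZero n}} → Carrier
  x /ℕ n = x / fromℕ n ⟨ fromℕ#0 n ⟩

record SimpleGraph (V : Set) : Set₁ where
  field
    Adj    : Rel V 0ℓ
    adj?   : Decidable Adj
    sym    : Symmetric Adj
    irrefl : ∀ {v} → ¬ Adj v v

count : ∀ {k} {P : U.Pred (Fin k) 0ℓ} → U.Decidable P → ℕ
count {k} P? = length (filter P? (allFin k))

module _ {k : ℕ} (G : SimpleGraph (Fin k)) where
  open SimpleGraph G

  degree : Fin k → ℕ
  degree v = count (λ w → adj? v w)

  commonNeighbours : Fin k → Fin k → ℕ
  commonNeighbours u v = count (λ w → adj? u w ×-dec adj? v w)

  record IsStronglyRegular (d λ′ μ : ℕ) : Set where
    field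
      regular     : ∀ v → degree v ≡ d
      adjacent    : ∀ u v → Adj u v → commonNeighbours u v ≡ λ′
      nonadjacent : ∀ u v → u ≢ v → ¬ Adj u v → commonNeighbours u v ≡ μ

data VertexColour : Set where
  black white : VertexColour

data EdgeColour : Set where
  black white gray : EdgeColour

_≟ⱽ_ : DecidableEquality VertexColour
black ≟ⱽ black = yes refl
black ≟ⱽ white = no λ ()
white ≟ⱽ black = no λ ()
white ≟ⱽ white = yes refl

_≟ᴱ_ : DecidableEquality EdgeColour
black ≟ᴱ black = yes refl
black ≟ᴱ white = no λ ()
black ≟ᴱ gray  = no λ ()
white ≟ᴱ black = no λ ()
white ≟ᴱ white = yes refl
white ≟ᴱ gray  = no λ ()
gray  ≟ᴱ black = no λ ()
gray  ≟ᴱ white = no λ ()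
gray  ≟ᴱ gray  = yes refl

-- A CRG on k vertices.  The values `edge v v` are junk: everything below looks
-- at `edge u v` only for u ≢ v.
record CRG (k : ℕ) : Set where
  field
    vertex   : Fin k → VertexColour
    edge     : Fin k → Fin k → EdgeColour
    edge-sym : ∀ u v → edge u v ≡ edge v u

  -- Each unordered pair {u , v} is listed once, as (u , v) with u < v.
  edges : List (Fin k × Fin k)
  edges = filter (λ (u , v) → u <ᶠ? v) (cartesianProduct (allFin k) (allFin k))

  verticesOf : VertexColour → List (Fin k)
  verticesOf c = filter (λ v → vertex v ≟ⱽ c) (allFin k)

  edgesOf : EdgeColour → List (Fin k × Fin k)
  edgesOf c = filter (λ (u , v) → edge u v ≟ᴱ c) edges

  VW VB : List (Fin k)
  VW = verticesOf white
  VB = verticesOf black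

  EW EB : List (Fin k × Fin k)
  EW = edgesOf white
  EB = edgesOf black

module _ {c ℓ₁ ℓ₂ ℓ₃} (F : OrderedField c ℓ₁ ℓ₂ ℓ₃) where
  open OrderedField F

  f : ∀ {k} .{{_ : NonZero k}} → CRG k → Carrier → Carrier
  f {k} K p =
    (1# /ℕ (k ℕ.^ 2)) {{ℕ.m^n≢0 k 2}} *
      ( p        * fromℕ (length VW ℕ.+ 2 ℕ.* length EW)
      + (1# - p) * fromℕ (length VB ℕ.+ 2 ℕ.* length EB))
    where open CRG K

record IsColouredHom {V : Set} {k : ℕ} (H : SimpleGraph V) (K : CRG k)
                     (φ : V → Fin k) : Set where
  open SimpleGraph H
  open CRG K
  field
    onEdges    : ∀ u v → u ≢ v → Adj u v →
                 (φ u ≡ φ v × vertex (φ u) ≡ black) ⊎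
                 (φ u ≢ φ v × (edge (φ u) (φ v) ≡ black ⊎ edge (φ u) (φ v) ≡ gray))
    onNonEdges : ∀ u v → u ≢ v → ¬ Adj u v →
                 (φ u ≡ φ v × vertex (φ u) ≡ white) ⊎
                 (φ u ≢ φ v × (edge (φ u) (φ v) ≡ white ⊎ edge (φ u) (φ v) ≡ gray))

_EmbedsIn_ : {V : Set} {k : ℕ} → SimpleGraph V → CRG k → Set
_EmbedsIn_ {V} {k} H K = Σ[ φ ∈ (V → Fin k) ] IsColouredHom H K φ

Forbids : {V : Set} {k : ℕ} → CRG k → SimpleGraph V → Set
Forbids K H = ¬ (H EmbedsIn K)

data Opposite {A B : Set} : Rel (A ⊎ B) 0ℓ where
  l-r : ∀ {a b} → Opposite (inj₁ a) (inj₂ b)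
  r-l : ∀ {a b} → Opposite (inj₂ b) (inj₁ a)

completeBipartite : (m n : ℕ) → SimpleGraph (Fin m ⊎ Fin n)
completeBipartite m n = record
  { Adj    = Opposite
  ; adj?   = λ { (inj₁ _) (inj₁ _) → no λ ()
               ; (inj₁ _) (inj₂ _) → yes l-r
               ; (inj₂ _) (inj₁ _) → yes r-l
               ; (inj₂ _) (inj₂ _) → no λ () }
  ; sym    = λ { l-r → r-l ; r-l → l-r }
  ; irrefl = λ ()
  }

adjacencyColour : {A : Set} → Dec A → EdgeColour
adjacencyColour (yes _) = gray
adjacencyColour (no _)  = white

correspondingCRG : ∀ {k} → SimpleGraph (Fin k) → CRG k
correspondingCRG G = record
  { vertex   = λ _ → black
  ; edge     = λ u v → adjacencyColour (adj? u v)
  ; edge-sym = λ u v → colour-cong sym sym (adj? u v) (adj? v u)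
  }
  where
  open SimpleGraph G
  colour-cong : {A B : Set} → (A → B) → (B → A) → (a? : Dec A) (b? : Dec B) →
                adjacencyColour a? ≡ adjacencyColour b?
  colour-cong f g (yes a) (yes b) = refl
  colour-cong f g (yes a) (no ¬b) with () ← ¬b (f a)
  colour-cong f g (no ¬a) (yes b) with () ← ¬a (g b)
  colour-cong f g (no ¬a) (no ¬b) = refl

-- Summing degrees gives 2|EW| = k² - k(d + 1), while |VB| = k and VW and EB are
-- empty; this is the formula for f.  An embedded K_{2,t} has its two-vertex side
-- on distinct x and y, and injects its other side into the intersection of the
-- closed neighbourhoods of x and y, which has λ + 2 elements if x and y are
-- adjacent and μ elements if not; both numbers are below t.  For λ = t - 3 and
-- μ = t - 1, counting walks of length 2 from a vertex gives
-- k(t - 1) = t - 1 + d(d + 1), which turns the first formula into the second.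
module Submission where

open import Defs
open import Algebra.Apartness.Bundles using (HeytingCommutativeRing)
open import Algebra.Bundles using (CommutativeRing)
import Algebra.Properties.Ring as RingProperties
import Algebra.Properties.Semiring.Mult as SemiringMult
import Algebra.Solver.Ring.NaturalCoefficients.Default as SemiringSolver
open import Data.Bool.Base using (if_then_else_; true; false)
open import Data.Fin.Base as Fin using (Fin; zero; suc)
import Data.Fin.Properties as Fin
open import Data.List.Base as List using (List; []; _∷_; _++_; length; filter; tabulate; allFin; cartesianProduct)
open import Data.List.Membership.Propositional using (_∈_)
open import Data.List.Membership.Propositional.Properties using (∈-filter⁺; ∈-allFin)
import Data.List.Properties as List
import Data.List.Relation.Unary.All as All
open import Data.List.Relation.Unary.Any using (here; there; index)
open import Data.List.Relation.Unary.Any.Properties using (lookup-index)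
open import Data.Nat.Base as ℕ using (ℕ; zero; suc; NonZero)
open import Data.Nat.ListAction using (sum)
open import Data.Nat.ListAction.Properties using (sum-++)
import Data.Nat.Properties as ℕ
open import Data.Nat.Solver using (module +-*-Solver)
open import Data.Product.Base using (_×_; _,_; proj₁; proj₂; Σ-syntax)
open import Data.Sum.Base using (_⊎_; inj₁; inj₂)
open import Function.Base using (_∘_; id)
open import Function.Bundles using (Equivalence)
open import Function.Definitions using (Injective)
open import Relation.Binary.Definitions using (tri<; tri≈; tri>)
open import Relation.Binary.PropositionalEquality as ≡ using (_≡_; _≢_; module ≡-Reasoning)
import Relation.Binary.Reasoning.Setoid as ≈-Reasoning
open import Relation.Nullary using (Dec; yes; no; does; ¬_; contradiction; _×-dec_)
open import Relation.Nullary.Decidable using (dec-true; dec-false; decidable-stable)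
open import Relation.Unary using (Pred; Decidable)

open import Algebra.Properties.Semiring.Sum ℕ.+-*-semiring
  using (sum-syntax; sum-cong-≗; sum-replicate-zero; ∑-distrib-+; ∑-comm;
         *-distribˡ-sum; *-distribʳ-sum)

private
  variable
    A B P Q : Set
    k : ℕ

-- Indicators and finite sums of natural numbers.

module _ where
  open import Data.Nat.Base using (_+_; _*_)
  open ≡ using (refl; sym; trans; cong; cong₂; subst)

  -- Reads only the boolean of the decision, so `𝟙 (suc u Fin.≟ suc v)` computes to `𝟙 (u Fin.≟ v)`.
  𝟙 : Dec P → ℕ
  𝟙 p? = if does p? then 1 else 0

  𝟙-true : (p? : Dec P) → P → 𝟙 p? ≡ 1
  𝟙-true p? p = cong (if_then 1 else 0) (dec-true p? p)

  𝟙-false : (p? : Dec P) → ¬ P → 𝟙 p? ≡ 0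
  𝟙-false p? ¬p = cong (if_then 1 else 0) (dec-false p? ¬p)

  𝟙-cong : (P → Q) → (Q → P) → (p? : Dec P) (q? : Dec Q) → 𝟙 p? ≡ 𝟙 q?
  𝟙-cong f g p? (yes q) = 𝟙-true p? (g q)
  𝟙-cong f g p? (no ¬q) = 𝟙-false p? (¬q ∘ f)

  𝟙-× : (p? : Dec P) (q? : Dec Q) → 𝟙 (p? ×-dec q?) ≡ 𝟙 p? * 𝟙 q?
  𝟙-× p? q? with does p?
  ... | true  = sym (ℕ.+-identityʳ _)
  ... | false = refl

  sum-const : ∀ n m → ∑[ i < n ] m ≡ n * m
  sum-const zero    m = refl
  sum-const (suc n) m = cong (m +_) (sum-const n m)

  ∑-δ : (u : Fin k) (g : Fin k → ℕ) → ∑[ v < k ] (𝟙 (u Fin.≟ v) * g v) ≡ g u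
  ∑-δ {suc k} zero g = begin
    g zero + 0 + ∑[ v < k ] 0  ≡⟨ cong₂ _+_ (ℕ.+-identityʳ _) (sum-replicate-zero k) ⟩
    g zero + 0                 ≡⟨ ℕ.+-identityʳ _ ⟩
    g zero                     ∎
    where open ≡-Reasoning
  -- The term at `zero` is `0 * g zero`, which computes away.
  ∑-δ (suc u) g = ∑-δ u (g ∘ suc)

  -- Lengths of filtered lists as sums of indicators.

  length-filter≡sum : {P : Pred A _} (P? : Decidable P) (xs : List A) →
                      length (filter P? xs) ≡ sum (List.map (𝟙 ∘ P?) xs)
  length-filter≡sum P? []       = refl
  length-filter≡sum P? (x ∷ xs) with does (P? x)
  ... | true  = cong suc (length-filter≡sum P? xs)
  ... | false = length-filter≡sum P? xs

  -- Needed because `edges` is itself a filtered list: its condition `u < v` becomes a factor of the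
  -- summand.
  sum-map-filter : {P : Pred A _} (P? : Decidable P) (w : A → ℕ) (xs : List A) →
                   sum (List.map w (filter P? xs)) ≡ sum (List.map (λ x → 𝟙 (P? x) * w x) xs)
  sum-map-filter P? w []       = refl
  sum-map-filter P? w (x ∷ xs) with does (P? x)
  ... | true  = cong₂ _+_ (sym (ℕ.+-identityʳ _)) (sum-map-filter P? w xs)
  ... | false = sum-map-filter P? w xs

  sum-map-tabulate : (w : A → ℕ) (h : Fin k → A) → sum (List.map w (tabulate h)) ≡ ∑[ i < k ] w (h i)
  sum-map-tabulate {k = zero}  w h = refl
  sum-map-tabulate {k = suc k} w h = cong (w (h zero) +_) (sum-map-tabulate w (h ∘ suc))

  sum-map-cartesianProduct : (w : A × B → ℕ) (xs : List A) (ys : List B) →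
    sum (List.map w (cartesianProduct xs ys)) ≡
    sum (List.map (λ x → sum (List.map (λ y → w (x , y)) ys)) xs)
  sum-map-cartesianProduct w []       ys = refl
  sum-map-cartesianProduct w (x ∷ xs) ys = begin
    sum (List.map w (List.map (x ,_) ys ++ zs))
      ≡⟨ cong sum (List.map-++ w (List.map (x ,_) ys) zs) ⟩
    sum (List.map w (List.map (x ,_) ys) ++ List.map w zs)
      ≡⟨ sum-++ (List.map w (List.map (x ,_) ys)) _ ⟩
    sum (List.map w (List.map (x ,_) ys)) + sum (List.map w zs)
      ≡⟨ cong₂ _+_ (cong sum (sym (List.map-∘ ys))) (sum-map-cartesianProduct w xs ys) ⟩
    sum (List.map (λ y → w (x , y)) ys) + _ ∎
    where
    open ≡-Reasoning
    zs = cartesianProduct xs ys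

  count≡∑ : {P : Pred (Fin k) _} (P? : Decidable P) → count P? ≡ ∑[ v < k ] 𝟙 (P? v)
  count≡∑ P? = trans (length-filter≡sum P? (allFin _)) (sum-map-tabulate (𝟙 ∘ P?) id)

  -- Symmetric double sums.

  𝟙-trichotomy : (u v : Fin k) → 𝟙 (u Fin.<? v) + 𝟙 (v Fin.<? u) + 𝟙 (u Fin.≟ v) ≡ 1
  𝟙-trichotomy u v with Fin.<-cmp u v
  ... | tri< u<v u≢v v≮u =
    cong₂ _+_ (cong₂ _+_ (𝟙-true (u Fin.<? v) u<v) (𝟙-false (v Fin.<? u) v≮u))
             (𝟙-false (u Fin.≟ v) u≢v)
  ... | tri≈ u≮v u≡v v≮u =
    cong₂ _+_ (cong₂ _+_ (𝟙-false (u Fin.<? v) u≮v) (𝟙-false (v Fin.<? u) v≮u))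
             (𝟙-true (u Fin.≟ v) u≡v)
  ... | tri> u≮v u≢v v<u =
    cong₂ _+_ (cong₂ _+_ (𝟙-false (u Fin.<? v) u≮v) (𝟙-true (v Fin.<? u) v<u))
             (𝟙-false (u Fin.≟ v) u≢v)

  -- Exchanging `u` and `v` turns the sum over `u < v` into the sum over `v < u`, and these two with
  -- the diagonal exhaust all ordered pairs. This relates edges, listed once each, to sums over
  -- ordered pairs.
  ∑∑-symmetric : (w : Fin k → Fin k → ℕ) → (∀ u v → w u v ≡ w v u) →
    2 * (∑[ u < k ] ∑[ v < k ] (𝟙 (u Fin.<? v) * w u v)) + ∑[ u < k ] w u u ≡ ∑[ u < k ] ∑[ v < k ] w u v
  ∑∑-symmetric {k} w w-sym = begin
    2 * S + ∑[ u < k ] w u u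
      ≡⟨ cong₂ _+_ (cong (S +_) (ℕ.+-identityʳ S)) (sum-cong-≗ (λ u → sym (∑-δ u (w u)))) ⟩
    S + S + ∑[ u < k ] ∑[ v < k ] (𝟙 (u Fin.≟ v) * w u v)
      ≡⟨ cong (λ T → S + T + D) (trans
           (∑-comm λ u v → 𝟙 (u Fin.<? v) * w u v)
           (sum-cong-≗ λ u → sum-cong-≗ λ v → cong (𝟙 (v Fin.<? u) *_) (w-sym v u))) ⟩
    S + ∑[ u < k ] ∑[ v < k ] (𝟙 (v Fin.<? u) * w u v) + ∑[ u < k ] ∑[ v < k ] (𝟙 (u Fin.≟ v) * w u v)
      ≡⟨ trans (∑∑-distrib-+ _ _) (cong (_+ D) (∑∑-distrib-+ _ _)) ⟨
    ∑[ u < k ] ∑[ v < k ] (𝟙 (u Fin.<? v) * w u v + 𝟙 (v Fin.<? u) * w u v + 𝟙 (u Fin.≟ v) * w u v)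
      ≡⟨ sum-cong-≗ (λ u → sum-cong-≗ (pointwise u)) ⟩
    ∑[ u < k ] ∑[ v < k ] w u v ∎
    where
    open ≡-Reasoning
    S = ∑[ u < k ] ∑[ v < k ] (𝟙 (u Fin.<? v) * w u v)
    D = ∑[ u < k ] ∑[ v < k ] (𝟙 (u Fin.≟ v) * w u v)
    ∑∑-distrib-+ : ∀ (g h : Fin k → Fin k → ℕ) →
      ∑[ u < k ] ∑[ v < k ] (g u v + h u v) ≡ ∑[ u < k ] ∑[ v < k ] g u v + ∑[ u < k ] ∑[ v < k ] h u v
    ∑∑-distrib-+ g h = trans (sum-cong-≗ λ u → ∑-distrib-+ (g u) (h u)) (∑-distrib-+ (λ u → ∑[ v < k ] g u v) _)
    pointwise : ∀ u v → 𝟙 (u Fin.<? v) * w u v + 𝟙 (v Fin.<? u) * w u v + 𝟙 (u Fin.≟ v) * w u v ≡ w u v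
    pointwise u v = begin
      a * w u v + b * w u v + c * w u v ≡⟨ solve 4 (λ a b c x →
          a :* x :+ b :* x :+ c :* x := (a :+ b :+ c) :* x) refl a b c (w u v) ⟩
      (a + b + c) * w u v               ≡⟨ cong (_* w u v) (𝟙-trichotomy u v) ⟩
      1 * w u v                         ≡⟨ ℕ.*-identityˡ _ ⟩
      w u v                             ∎
      where
      open +-*-Solver
      a = 𝟙 (u Fin.<? v)
      b = 𝟙 (v Fin.<? u)
      c = 𝟙 (u Fin.≟ v)

  -- Injections into lists, and colours given by adjacency.

  -- Looking up the position of `g i` in `ys` gives back `g i`, so distinct indices have distinct
  -- positions.
  injective∧∈⇒≤length : ∀ {n} {g : Fin n → A} {ys : List A} →
                        Injective _≡_ _≡_ g → (∀ i → g i ∈ ys) → n ℕ.≤ length ys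
  injective∧∈⇒≤length {g = g} {ys} g-inj g∈ys = Fin.injective⇒≤ {f = index ∘ g∈ys} λ {i} {j} eq → g-inj (begin
    g i                              ≡⟨ lookup-index (g∈ys i) ⟩
    List.lookup ys (index (g∈ys i))  ≡⟨ cong (List.lookup ys) eq ⟩
    List.lookup ys (index (g∈ys j))  ≡⟨ lookup-index (g∈ys j) ⟨
    g j                              ∎)
    where open ≡-Reasoning

  adjacencyColour≢black : (p? : Dec P) → adjacencyColour p? ≢ black
  adjacencyColour≢black (yes _) ()
  adjacencyColour≢black (no _)  ()

  adjacencyColour≡gray : (p? : Dec P) → adjacencyColour p? ≡ gray → P
  adjacencyColour≡gray (yes p) _ = p

  -- Walks of length 2 in a strongly regular graph.

  module _ {k d λ′ μ : ℕ} (G : SimpleGraph (Fin k)) (srg : IsStronglyRegular G d λ′ μ) where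
    open SimpleGraph G renaming (sym to Adj-sym)
    open IsStronglyRegular srg

    private
      K = correspondingCRG G
      open CRG K

    ∑-adj : ∀ v → ∑[ w < k ] 𝟙 (adj? v w) ≡ d
    ∑-adj v = trans (sym (count≡∑ (adj? v))) (regular v)

    ∑-adj′ : ∀ v → ∑[ w < k ] 𝟙 (adj? w v) ≡ d
    ∑-adj′ v = trans (sum-cong-≗ λ w → 𝟙-cong Adj-sym Adj-sym (adj? w v) (adj? v w)) (∑-adj v)

    -- The left side counts the walks `u`, `x`, `w` by their end `w`, returns to `u` included.
    -- Counted by the middle vertex instead, there are `d` choices of `x` and then `d` of `w`.
    ∑-commonNeighbours : ∀ u → ∑[ w < k ] commonNeighbours G u w ≡ d * d
    ∑-commonNeighbours u = begin
      ∑[ w < k ] commonNeighbours G u w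
        ≡⟨ sum-cong-≗ (λ w → trans (count≡∑ (λ x → adj? u x ×-dec adj? w x))
                                   (sum-cong-≗ λ x → 𝟙-× (adj? u x) (adj? w x))) ⟩
      ∑[ w < k ] ∑[ x < k ] (𝟙 (adj? u x) * 𝟙 (adj? w x))
        ≡⟨ ∑-comm (λ w x → 𝟙 (adj? u x) * 𝟙 (adj? w x)) ⟩
      ∑[ x < k ] ∑[ w < k ] (𝟙 (adj? u x) * 𝟙 (adj? w x))
        ≡⟨ sum-cong-≗ (λ x → trans (sym (*-distribˡ-sum (𝟙 (adj? u x)) (λ w → 𝟙 (adj? w x))))
                                   (cong (𝟙 (adj? u x) *_) (∑-adj′ x))) ⟩
      ∑[ x < k ] (𝟙 (adj? u x) * d)
        ≡⟨ *-distribʳ-sum d (λ x → 𝟙 (adj? u x)) ⟨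
      (∑[ x < k ] 𝟙 (adj? u x)) * d
        ≡⟨ cong (_* d) (∑-adj u) ⟩
      d * d ∎
      where open ≡-Reasoning

    -- One equation for the three cases: `d` common neighbours if `w` is `u`, `λ′` if adjacent, `μ`
    -- otherwise. The corrections by `μ` stand on the left to avoid subtraction in ℕ.
    commonNeighbours-cases : ∀ u w →
      commonNeighbours G u w + (𝟙 (u Fin.≟ w) * μ + 𝟙 (adj? u w) * μ) ≡
      μ + (𝟙 (u Fin.≟ w) * d + 𝟙 (adj? u w) * λ′)
    commonNeighbours-cases u w with u Fin.≟ w | adj? u w
    ... | yes refl | yes uu  = contradiction uu irrefl
    ... | yes refl | no _    = begin
      commonNeighbours G u u + (μ + 0 + 0) ≡⟨ cong (_+ (μ + 0 + 0)) cn≡d ⟩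
      d + (μ + 0 + 0)                      ≡⟨ solve 2 (λ d μ →
          d :+ (μ :+ con 0 :+ con 0) := μ :+ (d :+ con 0 :+ con 0)) refl d μ ⟩
      μ + (d + 0 + 0)                      ∎
      where
      open ≡-Reasoning
      open +-*-Solver
      cn≡d : commonNeighbours G u u ≡ d
      cn≡d = begin
        commonNeighbours G u u                       ≡⟨ count≡∑ (λ x → adj? u x ×-dec adj? u x) ⟩
        ∑[ x < k ] 𝟙 (adj? u x ×-dec adj? u x)       ≡⟨ sum-cong-≗ (λ x →
            𝟙-cong proj₁ (λ a → a , a) (adj? u x ×-dec adj? u x) (adj? u x)) ⟩
        ∑[ x < k ] 𝟙 (adj? u x)                      ≡⟨ ∑-adj u ⟩
        d                                            ∎
    ... | no _     | yes uw  = trans (cong (_+ (μ + 0)) (adjacent u w uw))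
        (solve 2 (λ l m → l :+ (m :+ con 0) := m :+ (l :+ con 0)) refl λ′ μ)
      where open +-*-Solver
    ... | no u≢w   | no ¬uw  = cong (_+ 0) (nonadjacent u w u≢w ¬uw)

    -- Double counting of the walks of length 2 that start at a fixed vertex.
    srg-parameters : Fin k → d * d + (μ + d * μ) ≡ k * μ + (d + d * λ′)
    srg-parameters u = begin
      d * d + (μ + d * μ)
        ≡⟨ cong₂ _+_ (∑-commonNeighbours u) (∑-cases μ μ) ⟨
      ∑[ w < k ] commonNeighbours G u w + ∑[ w < k ] (𝟙 (u Fin.≟ w) * μ + 𝟙 (adj? u w) * μ)
        ≡⟨ ∑-distrib-+ (commonNeighbours G u) _ ⟨
      ∑[ w < k ] (commonNeighbours G u w + (𝟙 (u Fin.≟ w) * μ + 𝟙 (adj? u w) * μ))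
        ≡⟨ sum-cong-≗ (commonNeighbours-cases u) ⟩
      ∑[ w < k ] (μ + (𝟙 (u Fin.≟ w) * d + 𝟙 (adj? u w) * λ′))
        ≡⟨ ∑-distrib-+ {k} (λ _ → μ) _ ⟩
      ∑[ w < k ] μ + ∑[ w < k ] (𝟙 (u Fin.≟ w) * d + 𝟙 (adj? u w) * λ′)
        ≡⟨ cong₂ _+_ (sum-const k μ) (∑-cases d λ′) ⟩
      k * μ + (d + d * λ′) ∎
      where
      open ≡-Reasoning
      ∑-cases : ∀ a b → ∑[ w < k ] (𝟙 (u Fin.≟ w) * a + 𝟙 (adj? u w) * b) ≡ a + d * b
      ∑-cases a b = begin
        ∑[ w < k ] (𝟙 (u Fin.≟ w) * a + 𝟙 (adj? u w) * b)
          ≡⟨ ∑-distrib-+ (λ w → 𝟙 (u Fin.≟ w) * a) _ ⟩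
        ∑[ w < k ] (𝟙 (u Fin.≟ w) * a) + ∑[ w < k ] (𝟙 (adj? u w) * b)
          ≡⟨ cong₂ _+_ (∑-δ u (λ _ → a)) (sym (*-distribʳ-sum b (λ w → 𝟙 (adj? u w)))) ⟩
        a + (∑[ w < k ] 𝟙 (adj? u w)) * b
          ≡⟨ cong (λ s → a + s * b) (∑-adj u) ⟩
        a + d * b ∎

    -- For `μ ≡ λ′ + 2` the sum `d + d * λ′` cancels from both sides of `srg-parameters`. The
    -- `Fin k` argument is the start of the walks.
    srg-order : Fin k → μ ≡ λ′ + 2 → k * μ ≡ μ + d * suc d
    srg-order u refl = ℕ.+-cancelʳ-≡ (d + d * λ′) _ _ (trans (sym (srg-parameters u))
      (solve 2 (λ d l →
          d :* d :+ (l :+ con 2 :+ d :* (l :+ con 2)) := l :+ con 2 :+ d :* (con 1 :+ d) :+ (d :+ d :* l)) refl d λ′))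
      where open +-*-Solver

    -- Sizes of the colour classes of `K`.

    length-VW : length VW ≡ 0
    length-VW = cong length (List.filter-none (λ v → vertex v ≟ⱽ white) (All.universal (λ _ ()) (allFin k)))

    length-VB : length VB ≡ k
    length-VB = trans (cong length (List.filter-all (λ v → vertex v ≟ⱽ black) (All.universal (λ _ → refl) (allFin k))))
                      (List.length-tabulate id)

    length-EB : length EB ≡ 0
    length-EB = cong length (List.filter-none (λ (u , v) → edge u v ≟ᴱ black)
                  (All.universal (λ (u , v) → adjacencyColour≢black (adj? u v)) edges))

    private
      white? : ∀ u v → Dec (edge u v ≡ white)
      white? u v = edge u v ≟ᴱ white

      𝟙-white+𝟙-adj : ∀ u v → 𝟙 (white? u v) + 𝟙 (adj? u v) ≡ 1
      𝟙-white+𝟙-adj u v with adj? u v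
      ... | yes _ = refl
      ... | no _  = refl

      -- The junk value `edge u u` is white because `G` has no loops. These `k` diagonal terms
      -- account for the `1` in `suc d` in the count of white edges.
      𝟙-white-diagonal : ∀ u → 𝟙 (white? u u) ≡ 1
      𝟙-white-diagonal u with adj? u u
      ... | yes uu = contradiction uu irrefl
      ... | no _   = refl

    length-EW : length EW ≡ ∑[ u < k ] ∑[ v < k ] (𝟙 (u Fin.<? v) * 𝟙 (white? u v))
    length-EW = begin
      length EW
        ≡⟨ length-filter≡sum _ edges ⟩
      sum (List.map (λ (u , v) → 𝟙 (white? u v)) edges)
        ≡⟨ sum-map-filter _ _ (cartesianProduct (allFin k) (allFin k)) ⟩
      sum (List.map (λ (u , v) → 𝟙 (u Fin.<? v) * 𝟙 (white? u v)) (cartesianProduct (allFin k) (allFin k)))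
        ≡⟨ sum-map-cartesianProduct _ (allFin k) (allFin k) ⟩
      sum (List.map (λ u → sum (List.map (λ v → 𝟙 (u Fin.<? v) * 𝟙 (white? u v)) (allFin k))) (allFin k))
        ≡⟨ sum-map-tabulate {k = k} _ id ⟩
      ∑[ u < k ] sum (List.map (λ v → 𝟙 (u Fin.<? v) * 𝟙 (white? u v)) (allFin k))
        ≡⟨ sum-cong-≗ (λ u → sum-map-tabulate {k = k} (λ v → 𝟙 (u Fin.<? v) * 𝟙 (white? u v)) id) ⟩
      ∑[ u < k ] ∑[ v < k ] (𝟙 (u Fin.<? v) * 𝟙 (white? u v)) ∎
      where open ≡-Reasoning

    -- Each of the `k * k` ordered pairs is either white or adjacent. The white ones are the white
    -- edges in both orders and the diagonal; the adjacent ones number `k * d`.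
    2*length-EW : 2 * length EW + k * suc d ≡ k * k
    2*length-EW = begin
      2 * length EW + k * suc d
        ≡⟨ solve 3 (λ e k d →
            con 2 :* e :+ k :* (con 1 :+ d) := con 2 :* e :+ k :* con 1 :+ k :* d) refl (length EW) k d ⟩
      2 * length EW + k * 1 + k * d
        ≡⟨ cong₂ (λ a b → 2 * a + b + k * d) length-EW
             (trans (sym (sum-const k 1)) (sum-cong-≗ (sym ∘ 𝟙-white-diagonal))) ⟩
      2 * (∑[ u < k ] ∑[ v < k ] (𝟙 (u Fin.<? v) * 𝟙 (white? u v))) + ∑[ u < k ] 𝟙 (white? u u) + k * d
        ≡⟨ cong₂ _+_ (∑∑-symmetric (λ u v → 𝟙 (white? u v)) (λ u v → cong (λ c → 𝟙 (c ≟ᴱ white)) (edge-sym u v)))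
                     (trans (sym (sum-const k d)) (sum-cong-≗ (sym ∘ ∑-adj))) ⟩
      ∑[ u < k ] ∑[ v < k ] 𝟙 (white? u v) + ∑[ u < k ] ∑[ v < k ] 𝟙 (adj? u v)
        ≡⟨ ∑-distrib-+ (λ u → ∑[ v < k ] 𝟙 (white? u v)) _ ⟨
      ∑[ u < k ] (∑[ v < k ] 𝟙 (white? u v) + ∑[ v < k ] 𝟙 (adj? u v))
        ≡⟨ sum-cong-≗ (λ u → trans (sym (∑-distrib-+ (λ v → 𝟙 (white? u v)) _)) (sum-cong-≗ (𝟙-white+𝟙-adj u))) ⟩
      ∑[ u < k ] ∑[ v < k ] 1
        ≡⟨ sum-cong-≗ {k} (λ _ → trans (sum-const k 1) (ℕ.*-identityʳ k)) ⟩
      ∑[ u < k ] k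
        ≡⟨ sum-const k k ⟩
      k * k ∎
      where
      open ≡-Reasoning
      open +-*-Solver

    -- Excluding an embedded `completeBipartite 2 t`.

    forbids : ∀ t → λ′ + 3 ℕ.≤ t → μ + 1 ℕ.≤ t → Forbids K (completeBipartite 2 t)
    forbids t λ+3≤t μ+1≤t (φ , hom) = ℕ.<-irrefl refl t<t
      where
      open IsColouredHom hom

      g : Fin t → Fin k
      g i = φ (inj₂ i)

      x y : Fin k
      x = φ (inj₁ zero)
      y = φ (inj₁ (suc zero))

      -- Only a white vertex could absorb a nonadjacent pair, and `K` has none.
      distinct : ∀ u v → u ≢ v → ¬ Opposite u v → φ u ≢ φ v
      distinct u v u≢v ¬uv with onNonEdges u v u≢v ¬uv
      ... | inj₁ (_ , ())
      ... | inj₂ (φu≢φv , _) = φu≢φv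

      g-injective : Injective _≡_ _≡_ g
      g-injective {i} {j} gi≡gj = decidable-stable (i Fin.≟ j)
        λ i≢j → distinct (inj₂ i) (inj₂ j) (λ { refl → i≢j refl }) (λ ()) gi≡gj

      -- As `K` has no black edges, an edge either collapses to a black vertex or goes to a gray
      -- edge, which is an edge of `G`.
      closed : ∀ a i → φ (inj₁ a) ≡ g i ⊎ Adj (φ (inj₁ a)) (g i)
      closed a i with onEdges (inj₁ a) (inj₂ i) (λ ()) l-r
      ... | inj₁ (φa≡gi , _)       = inj₁ φa≡gi
      ... | inj₂ (_ , inj₁ isBlack) = contradiction isBlack (adjacencyColour≢black (adj? _ _))
      ... | inj₂ (_ , inj₂ isGray)  = inj₂ (adjacencyColour≡gray (adj? _ _) isGray)

      common : List (Fin k)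
      common = filter (λ v → adj? x v ×-dec adj? y v) (allFin k)

      ∈-common : ∀ {v} → Adj x v → Adj y v → v ∈ common
      ∈-common xv yv = ∈-filter⁺ (λ v → adj? x v ×-dec adj? y v) (∈-allFin _) (xv , yv)

      x≢y : x ≢ y
      x≢y = distinct (inj₁ zero) (inj₁ (suc zero)) (λ ()) (λ ())

      t<t : t ℕ.< t
      t<t with adj? x y
      ... | yes xy = begin-strict
        t                         ≤⟨ injective∧∈⇒≤length g-injective covered ⟩
        2 + commonNeighbours G x y ≡⟨ cong (2 +_) (adjacent x y xy) ⟩
        -- The strict inequality unfolds to `3 + λ′ ≤ λ′ + 3`.
        2 + λ′                    <⟨ ℕ.≤-reflexive (ℕ.+-comm 3 λ′) ⟩
        λ′ + 3                    ≤⟨ λ+3≤t ⟩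
        t                         ∎
        where
        open ℕ.≤-Reasoning
        -- The images may also hit `x` and `y` here, hence the extra 2 in the bound.
        covered : ∀ i → g i ∈ x ∷ y ∷ common
        covered i with closed zero i | closed (suc zero) i
        ... | inj₁ x≡gi | _         = here (sym x≡gi)
        ... | inj₂ _    | inj₁ y≡gi = there (here (sym y≡gi))
        ... | inj₂ xgi  | inj₂ ygi  = there (there (∈-common xgi ygi))
      ... | no ¬xy = begin-strict
        t                      ≤⟨ injective∧∈⇒≤length g-injective covered ⟩
        commonNeighbours G x y ≡⟨ nonadjacent x y x≢y ¬xy ⟩
        μ                      <⟨ ℕ.≤-reflexive (ℕ.+-comm 1 μ) ⟩
        μ + 1                  ≤⟨ μ+1≤t ⟩
        t                      ∎
        where
        open ℕ.≤-Reasoning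
        -- If `g i` were `x` or `y`, then `x` and `y` would be adjacent or equal.
        covered : ∀ i → g i ∈ common
        covered i with closed zero i | closed (suc zero) i
        ... | inj₁ x≡gi | inj₁ y≡gi = contradiction (trans x≡gi (sym y≡gi)) x≢y
        ... | inj₁ x≡gi | inj₂ ygi  = contradiction (Adj-sym (subst (Adj y) (sym x≡gi) ygi)) ¬xy
        ... | inj₂ xgi  | inj₁ y≡gi = contradiction (subst (Adj x) (sym y≡gi) xgi) ¬xy
        ... | inj₂ xgi  | inj₂ ygi  = ∈-common xgi ygi

-- Natural numbers and quotients in an ordered field.

module _ {c ℓ₁ ℓ₂ ℓ₃} (F : OrderedField c ℓ₁ ℓ₂ ℓ₃) where
  open OrderedField F
  open CommutativeRing (HeytingCommutativeRing.commutativeRing heytingCommutativeRing)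
    using (ring; semiring; commutativeSemiring)
  open RingProperties ring using (+-cancelʳ)
  open SemiringMult semiring using (×-homo-+; ×1-homo-*)
  open SemiringSolver commutativeSemiring using (solve; con; _:=_; _:+_; _:*_)
  open ≈-Reasoning setoid

  fromℕ-+ : ∀ m n → fromℕ (m ℕ.+ n) ≈ fromℕ m + fromℕ n
  fromℕ-+ = ×-homo-+ 1#

  fromℕ-* : ∀ m n → fromℕ (m ℕ.* n) ≈ fromℕ m * fromℕ n
  fromℕ-* = ×1-homo-*

  fromℕ-cong : ∀ {m n} → m ≡ n → fromℕ m ≈ fromℕ n
  fromℕ-cong ≡.refl = refl

  x-y+y≈x : ∀ x y → x - y + y ≈ x
  x-y+y≈x x y = trans (+-assoc x (- y) y) (trans (+-congˡ (-‿inverseˡ y)) (+-identityʳ x))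

  x-0≈x : ∀ x → x - 0# ≈ x
  x-0≈x x = trans (sym (+-identityʳ _)) (x-y+y≈x x 0#)

  -- Reduces every later claim about a quotient to one about a product.
  /-unique : ∀ {x y z} (y#0 : y # 0#) → z * y ≈ x → x / y ⟨ y#0 ⟩ ≈ z
  /-unique {x} {y} {z} y#0 zy≈x = begin
    x * y⁻¹              ≈⟨ *-congʳ zy≈x ⟨
    z * y * y⁻¹          ≈⟨ *-assoc z y y⁻¹ ⟩
    z * (y * y⁻¹)        ≈⟨ *-congˡ (*-congʳ (x-0≈x y)) ⟨
    z * ((y - 0#) * y⁻¹) ≈⟨ *-congˡ (proj₂ (proj₂ (#⇒invertible y#0))) ⟩
    z * 1#               ≈⟨ *-identityʳ z ⟩
    z                    ∎
    where
    y⁻¹ = proj₁ (#⇒invertible y#0)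

  /-cancel : ∀ {x y} (y#0 : y # 0#) → (x / y ⟨ y#0 ⟩) * y ≈ x
  /-cancel {x} {y} y#0 = begin
    x * y⁻¹ * y          ≈⟨ *-assoc x y⁻¹ y ⟩
    x * (y⁻¹ * y)        ≈⟨ *-congˡ (*-congˡ (x-0≈x y)) ⟨
    x * (y⁻¹ * (y - 0#)) ≈⟨ *-congˡ (proj₁ (proj₂ (#⇒invertible y#0))) ⟩
    x * 1#               ≈⟨ *-identityʳ x ⟩
    x                    ∎
    where
    y⁻¹ = proj₁ (#⇒invertible y#0)

  -- The two formulas for `f`.

  module _ {k d λ′ μ : ℕ} .{{_ : NonZero k}} (G : SimpleGraph (Fin k)) (srg : IsStronglyRegular G d λ′ μ) where
    private
      K = correspondingCRG G
      open CRG K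
      κ = fromℕ k
      δ = fromℕ d
      E = fromℕ (2 ℕ.* length EW)
      M = κ - δ - fromℕ 2

      a : Carrier
      a = 1# /ℕ k

      aκ≈1 : a * κ ≈ 1#
      aκ≈1 = /-cancel (fromℕ#0 k)

      -- The solver handles semirings only, so `M` is an atom to it and enters the calculations
      -- through this equation; likewise `a` enters through `aκ≈1`.
      M+δ+2≈κ : M + fromℕ 2 + δ ≈ κ
      M+δ+2≈κ = trans (+-congʳ (x-y+y≈x (κ - δ) (fromℕ 2))) (x-y+y≈x κ δ)

    1/k²≈a² : (1# /ℕ (k ℕ.^ 2)) {{ℕ.m^n≢0 k 2}} ≈ a * a
    1/k²≈a² = /-unique (fromℕ#0 (k ℕ.^ 2) {{ℕ.m^n≢0 k 2}}) (begin
      -- `k ^ 2` computes to `k * (k * 1)`.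
      a * a * fromℕ (k ℕ.^ 2)     ≈⟨ *-congˡ (trans (fromℕ-cong (≡.cong (k ℕ.*_) (ℕ.*-identityʳ k))) (fromℕ-* k k)) ⟩
      a * a * (κ * κ)             ≈⟨ solve 2 (λ a κ → a :* a :* (κ :* κ) := a :* κ :* (a :* κ)) refl a κ ⟩
      a * κ * (a * κ)             ≈⟨ *-cong aκ≈1 aκ≈1 ⟩
      1# * 1#                     ≈⟨ *-identityˡ 1# ⟩
      1#                          ∎)

    E+κ[1+δ]≈κ² : E + κ * (1# + δ) ≈ κ * κ
    E+κ[1+δ]≈κ² = begin
      E + κ * (1# + δ)                            ≈⟨ +-congˡ (fromℕ-* k (suc d)) ⟨
      E + fromℕ (k ℕ.* suc d)                     ≈⟨ fromℕ-+ (2 ℕ.* length EW) (k ℕ.* suc d) ⟨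
      fromℕ (2 ℕ.* length EW ℕ.+ k ℕ.* suc d)     ≈⟨ fromℕ-cong (2*length-EW G srg) ⟩
      fromℕ (k ℕ.* k)                             ≈⟨ fromℕ-* k k ⟩
      κ * κ                                       ∎

    -- Adding `a * (1# + δ)` makes both sides equal to `a * κ`: on the left by the count of white
    -- edges, on the right by the definition of `M`.
    a²E≈aM+a : a * a * E ≈ a * M + a
    a²E≈aM+a = +-cancelʳ (a * (1# + δ)) _ _ (begin
      a * a * E + a * (1# + δ)            ≈⟨ +-congˡ (*-identityˡ _) ⟨
      a * a * E + 1# * (a * (1# + δ))     ≈⟨ +-congˡ (*-congʳ aκ≈1) ⟨
      -- The inserted factor `a * κ` lets `a * a` be taken out of both summands.
      a * a * E + a * κ * (a * (1# + δ))  ≈⟨ solve 4 (λ a κ δ E →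
          a :* a :* E :+ a :* κ :* (a :* (con 1 :+ δ)) := a :* a :* (E :+ κ :* (con 1 :+ δ))) refl a κ δ E ⟩
      a * a * (E + κ * (1# + δ))          ≈⟨ *-congˡ E+κ[1+δ]≈κ² ⟩
      a * a * (κ * κ)                     ≈⟨ solve 2 (λ a κ →
          a :* a :* (κ :* κ) := a :* κ :* (a :* κ)) refl a κ ⟩
      a * κ * (a * κ)                     ≈⟨ *-congʳ aκ≈1 ⟩
      1# * (a * κ)                        ≈⟨ *-identityˡ _ ⟩
      a * κ                               ≈⟨ *-congˡ M+δ+2≈κ ⟨
      a * (M + fromℕ 2 + δ)               ≈⟨ solve 3 (λ a M δ →
          a :* (M :+ (con 1 :+ (con 1 :+ con 0)) :+ δ) := a :* M :+ a :+ a :* (con 1 :+ δ)) refl a M δ ⟩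
      a * M + a + a * (1# + δ)            ∎)

    -- White edges contribute `p * (a * M + a)` and black vertices `(1# - p) * a`; the multiples of
    -- `a` alone add up to `a`.
    f≈a+aMp : ∀ p → f F K p ≈ a + a * M * p
    f≈a+aMp p = begin
      f F K p
        ≈⟨ *-cong 1/k²≈a² (+-cong
             (*-congˡ (fromℕ-cong (≡.cong (ℕ._+ 2 ℕ.* length EW) (length-VW G srg))))
             (*-congˡ (fromℕ-cong (≡.trans (≡.cong₂ (λ b e → b ℕ.+ 2 ℕ.* e) (length-VB G srg) (length-EB G srg)) (ℕ.+-identityʳ k))))) ⟩
      a * a * (p * E + q * κ)
        ≈⟨ solve 5 (λ a p q E κ →
            a :* a :* (p :* E :+ q :* κ) := p :* (a :* a :* E) :+ q :* a :* (a :* κ)) refl a p q E κ ⟩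
      p * (a * a * E) + q * a * (a * κ)
        ≈⟨ +-cong (*-congˡ a²E≈aM+a) (trans (*-congˡ aκ≈1) (*-identityʳ (q * a))) ⟩
      p * (a * M + a) + q * a
        ≈⟨ solve 4 (λ a p q M → p :* (a :* M :+ a) :+ q :* a := (q :+ p) :* a :+ a :* M :* p) refl a p q M ⟩
      (q + p) * a + a * M * p
        ≈⟨ +-congʳ (trans (*-congʳ (x-y+y≈x 1# p)) (*-identityˡ a)) ⟩
      a + a * M * p ∎
      where q = 1# - p

    f-formula : ∀ p → f F K p ≈ 1# /ℕ k + (M /ℕ k) * p
    f-formula p = trans (f≈a+aMp p) (+-congˡ (*-congʳ (sym (/-unique (fromℕ#0 k) (begin
      a * M * κ   ≈⟨ solve 3 (λ a M κ → a :* M :* κ := M :* (a :* κ)) refl a M κ ⟩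
      M * (a * κ) ≈⟨ *-congˡ aκ≈1 ⟩
      M * 1#      ≈⟨ *-identityʳ M ⟩
      M           ∎)))))

    -- Rewrites the slope in terms of `1/k`, ready for substituting another expression for `1/k`.
    aM≈1-[δ+2]a : a * M ≈ 1# - (δ + fromℕ 2) * a
    aM≈1-[δ+2]a = +-cancelʳ ((δ + fromℕ 2) * a) _ _ (begin
      a * M + (δ + fromℕ 2) * a             ≈⟨ solve 4 (λ a M δ t →
          a :* M :+ (δ :+ t) :* a := a :* (M :+ t :+ δ)) refl a M δ (fromℕ 2) ⟩
      a * (M + fromℕ 2 + δ)                 ≈⟨ *-congˡ M+δ+2≈κ ⟩
      a * κ                                 ≈⟨ aκ≈1 ⟩
      1#                                    ≈⟨ x-y+y≈x 1# _ ⟨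
      1# - (δ + fromℕ 2) * a + (δ + fromℕ 2) * a ∎)

    -- The walk count gives `D ≈ κ * τ`, so `a`, the inverse of `κ`, equals `τ / D`; substituting
    -- this for `a` in the first formula yields the claim.
    f-formula-extremal : ∀ t → λ′ ℕ.+ 3 ≡ t → μ ℕ.+ 1 ≡ t →
      (let D = (fromℕ t - 1#) + fromℕ d * (fromℕ d + 1#)) →
      Σ[ D#0 ∈ D # 0# ] (∀ p → f F K p ≈ (fromℕ t - 1#) / D ⟨ D#0 ⟩
        + (1# - ((fromℕ d + fromℕ 2) * (fromℕ t - 1#)) / D ⟨ D#0 ⟩) * p)
    f-formula-extremal t λ+3≡t μ+1≡t = D#0 , λ p → begin
      f F K p
        ≈⟨ f≈a+aMp p ⟩
      a + a * M * p
        ≈⟨ +-congˡ (*-congʳ aM≈1-[δ+2]a) ⟩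
      a + (1# - (δ + fromℕ 2) * a) * p
        ≈⟨ +-cong (/-unique D#0 aD≈τ)
             (*-congʳ (+-congˡ (-‿cong (/-unique D#0 (trans (*-assoc _ a D) (*-congˡ aD≈τ)))))) ⟨
      τ / D ⟨ D#0 ⟩ + (1# - ((δ + fromℕ 2) * τ) / D ⟨ D#0 ⟩) * p ∎
      where
      τ = fromℕ t - 1#
      D = τ + δ * (δ + 1#)

      t≡1+μ : t ≡ suc μ
      t≡1+μ = ≡.trans (≡.sym μ+1≡t) (ℕ.+-comm μ 1)

      μ≡λ+2 : μ ≡ λ′ ℕ.+ 2
      μ≡λ+2 = ℕ.suc-injective (≡.trans (≡.sym t≡1+μ) (≡.trans (≡.sym λ+3≡t) (ℕ.+-suc λ′ 2)))

      kμ≡μ+d[1+d] : k ℕ.* μ ≡ μ ℕ.+ d ℕ.* suc d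
      -- The walks start at vertex 0, which exists because `k` is nonzero.
      kμ≡μ+d[1+d] = srg-order G srg (Fin.fromℕ< (ℕ.>-nonZero⁻¹ k)) μ≡λ+2

      τ≈μ : τ ≈ fromℕ μ
      τ≈μ = +-cancelʳ 1# _ _ (trans (x-y+y≈x (fromℕ t) 1#) (trans (fromℕ-cong t≡1+μ) (+-comm 1# (fromℕ μ))))

      D≈μ+d[1+d] : D ≈ fromℕ (μ ℕ.+ d ℕ.* suc d)
      D≈μ+d[1+d] = begin
        τ + δ * (δ + 1#)                  ≈⟨ +-cong τ≈μ (*-congˡ (+-comm δ 1#)) ⟩
        fromℕ μ + δ * fromℕ (suc d)       ≈⟨ +-congˡ (fromℕ-* d (suc d)) ⟨
        fromℕ μ + fromℕ (d ℕ.* suc d)     ≈⟨ fromℕ-+ μ (d ℕ.* suc d) ⟨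
        fromℕ (μ ℕ.+ d ℕ.* suc d)         ∎

      D≈κτ : D ≈ κ * τ
      D≈κτ = begin
        D                         ≈⟨ D≈μ+d[1+d] ⟩
        fromℕ (μ ℕ.+ d ℕ.* suc d) ≈⟨ fromℕ-cong kμ≡μ+d[1+d] ⟨
        fromℕ (k ℕ.* μ)           ≈⟨ fromℕ-* k μ ⟩
        κ * fromℕ μ               ≈⟨ *-congˡ τ≈μ ⟨
        κ * τ                     ∎

      -- Exhibits `D` as the image of a successor, hence positive, since `μ` is `λ′ + 2`.
      μ+d[1+d]≡1+n : μ ℕ.+ d ℕ.* suc d ≡ suc (λ′ ℕ.+ 1 ℕ.+ d ℕ.* suc d)
      μ+d[1+d]≡1+n = ≡.cong (ℕ._+ d ℕ.* suc d) (≡.trans μ≡λ+2 (ℕ.+-suc λ′ 1))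

      D#0 : D # 0#
      D#0 = Equivalence.from #⇔<⊎> (inj₂ (<.<-respʳ-≈
        (sym (trans D≈μ+d[1+d] (fromℕ-cong μ+d[1+d]≡1+n))) (0<fromℕ-suc (λ′ ℕ.+ 1 ℕ.+ d ℕ.* suc d))))

      aD≈τ : a * D ≈ τ
      aD≈τ = begin
        a * D        ≈⟨ *-congˡ D≈κτ ⟩
        a * (κ * τ)  ≈⟨ *-assoc a κ τ ⟨
        a * κ * τ    ≈⟨ *-congʳ aκ≈1 ⟩
        1# * τ       ≈⟨ *-identityˡ τ ⟩
        τ            ∎

theorem10 :
  ∀ {c ℓ₁ ℓ₂ ℓ₃} (F : OrderedField c ℓ₁ ℓ₂ ℓ₃) (let open OrderedField F)
  (k d λ′ μ : ℕ) .{{_ : NonZero k}}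
  (G : SimpleGraph (Fin k)) → IsStronglyRegular G d λ′ μ →
  (let K = correspondingCRG G) →
  (∀ p → 0# ≤ p → p ≤ 1# →
    f F K p ≈ 1# /ℕ k + ((fromℕ k - fromℕ d - fromℕ 2) /ℕ k) * p)
  ×
  (∀ t → λ′ ℕ.+ 3 ℕ.≤ t → μ ℕ.+ 1 ℕ.≤ t →
    Forbids K (completeBipartite 2 t))
  ×
  (∀ t → λ′ ℕ.+ 3 ≡ t → μ ℕ.+ 1 ≡ t →
    (let D = (fromℕ t - 1#) + fromℕ d * (fromℕ d + 1#)) →
    Σ[ D#0 ∈ D # 0# ] (∀ p → 0# ≤ p → p ≤ 1# →
      f F K p ≈ (fromℕ t - 1#) / D ⟨ D#0 ⟩
              + (1# - ((fromℕ d + fromℕ 2) * (fromℕ t - 1#)) / D ⟨ D#0 ⟩) * p))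
theorem10 F k d λ′ μ G srg =
    (λ p _ _ → f-formula F G srg p)
  , forbids G srg
  , λ t λ+3≡t μ+1≡t →
      let D#0 , f≈ = f-formula-extremal F G srg t λ+3≡t μ+1≡t
      in D#0 , λ p _ _ → f≈ p
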